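{- Let $q=2^m$ and let $e$ be an integer with $1\le e<m$. Then every $e$-Klenian polynomial $f\in\mathbb F_q[X,Y]$ has a companion.
   Context: $q$ is a prime power and $\mathbb F_q=\{c_0,\dots,c_{q-1}\}$ is a fixed enumeration; $\mathfrak S_q$ is the symmetric group of permutations of $\mathbb F_q$, composed right to left, written in cycle notation. Every function $\mathbb F_q^2\to\mathbb F_q$ is identified with the unique polynomial in $\mathbb F_q[X,Y]$ of degree $<q$ in each variable representing it. $f\in\mathbb F_q[X,Y]$ is a local permutation polynomial (LPP) if $x\mapsto f(x,y_0)$ and $y\mapsto f(x_0,y)$ are permutations of $\mathbb F_q$ for all $x_0,y_0$. A permutation polynomial tuple is $(\beta_0,\dots,\beta_{q-1})\in\mathfrak S_q^q$ such that $\beta_i^{ -1}\beta_j$ has no fixed point whenever $i\ne j$; LPPs $f$ correspond bijectively to such tuples via $f(x,\beta_i(x))=c_i$ for all $x$ and all $i$. Two LPPs $f,g$ are orthogonal (companions) if for every $(a,b)\in\mathbb F_q^2$ the system $f(X,Y)=a$, $g(X,Y)=b$ has exactly one solution in $\mathbb F_q^2$; a companion of $f$ is an LPP orthogonal to $f$. $e$-Klenian polynomials: for $q=p^r$, $0\le e<r$, $\ell=p^e$, $t=q/\ell$, let $\alpha=\prod_{i=0}^{t-1}(c_{i\ell},c_{i\ell+1},\dots,c_{(i+1)\ell-1})$, $\beta=\prod_{j=0}^{\ell-1}(c_j,c_{j+\ell},\dots,c_{j+(t-1)\ell})$ and $G=\{\alpha^i\beta^j:0\le i\le \ell-1,0\le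 j\le t-1\}$ (a subgroup of $\mathfrak S_q$ of order $q$ whose non-identity elements have no fixed points); an $e$-Klenian polynomial is an LPP whose permutation polynomial tuple consists of the $q$ elements of $G$ in some order. -}

module Defs where

open import Level using (Level) renaming (suc to lsuc)
open import Algebra.Apartness.Structures using (IsHeytingField)
open import Algebra.Bundles using (CommutativeRing)
import Algebra.Properties.Monoid.Sum as MonoidSum
import Algebra.Properties.Semiring.Exp as SemiringExp
open import Data.Fin using (Fin; toℕ; combine; cast)
open import Data.Fin.Properties using (any?; inj⇒≟)
open import Data.Nat as ℕ using (ℕ; suc; NonZero; _/_; _∸_)
open import Data.Nat.Divisibility using (_∣_; divides)
open import Data.Nat.DivMod using (_mod_; m/n*n≡m)
import Data.Nat.Properties as ℕ
open import Data.Product using (∃; ∃₂; ∃!; _×_; _,_)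
open import Data.Vec.Functional using (Vector; foldr)
open import Function using (_∘′_; id)
open import Function.Bundles using (_↔_; Inverse)
open import Function.Definitions using (Bijective)
import Function.Endo.Propositional as Endo
open import Function.Properties.Inverse using (↔-sym; ↔⇒↣)
open import Relation.Binary.Definitions using (DecidableEquality)
open import Relation.Binary.PropositionalEquality
  using (_≡_; _≢_; _≗_; sym; trans; cong)
open import Relation.Nullary using (yes; no)

open Inverse using (to; from)

-- A field with q elements together with a fixed enumeration c₀, …, c_{q-1}.
-- With _≢_ as the apartness relation, a Heyting field is an ordinary field.
record FiniteField (a : Level) (q : ℕ) : Set (lsuc a) where
  infix  8 -_
  infixl 7 _*_
  infixl 6 _+_
  field
    Carrier : Set a
    _+_ _*_ : Carrier → Carrier → Carrier
    -_      : Carrier → Carrier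
    0# 1#   : Carrier
    isField : IsHeytingField _≡_ _≢_ _+_ _*_ -_ 0# 1#
    c       : Fin q ↔ Carrier

  open IsHeytingField isField public using (isCommutativeRing)

  commutativeRing : CommutativeRing a a
  commutativeRing = record { isCommutativeRing = isCommutativeRing }

  open MonoidSum (CommutativeRing.+-monoid commutativeRing) public
    using (sum-syntax)
  open SemiringExp (CommutativeRing.semiring commutativeRing) public
    using (_^_)

  _≟_ : DecidableEquality Carrier
  _≟_ = inj⇒≟ (↔⇒↣ (↔-sym c))

module _ {a q} (F : FiniteField a q) where
  open FiniteField F

  -- Polynomials in X, Y of degree < q in each variable; f i j is the
  -- coefficient of X^i Y^j.
  Poly : Set a
  Poly = Vector (Vector Carrier q) q

  eval : Poly → Carrier → Carrier → Carrier
  eval f x y =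
    ∑[ i < q ] ∑[ j < q ] (f i j * x ^ toℕ i * y ^ toℕ j)

  IsLPP : Poly → Set a
  IsLPP f = (∀ y₀ → Bijective _≡_ _≡_ (λ x → eval f x y₀))
          × (∀ x₀ → Bijective _≡_ _≡_ (λ y → eval f x₀ y))

  Orthogonal : Poly → Poly → Set a
  Orthogonal f g = ∀ u v →
    ∃! _≡_ λ ((x , y) : Carrier × Carrier) → eval f x y ≡ u × eval g x y ≡ v

  IsCompanion : Poly → Poly → Set a
  IsCompanion f g = IsLPP g × Orthogonal f g

  IsPermutationPolynomialTuple : Vector (Carrier ↔ Carrier) q → Set a
  IsPermutationPolynomialTuple τ =
    ∀ i j → i ≢ j → ∀ x → from (τ i) (to (τ j) x) ≢ x

  IsTupleOf : Poly → Vector (Carrier ↔ Carrier) q → Set a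
  IsTupleOf f τ = ∀ i x → eval f x (to (τ i) x) ≡ to c i

next : ∀ {n} → Fin n → Fin n
next {suc n} k = suc (toℕ k) mod suc n

module _ {a} {A : Set a} (_≟_ : DecidableEquality A) where

  -- The cycle (s₀, s₁, …, s_{n-1}), for distinct s₀, …, s_{n-1}.
  cycle : ∀ {n} → Vector A n → A → A
  cycle s x with any? (λ k → s k ≟ x)
  ... | yes (k , _) = s (next k)
  ... | no  _       = x

∏ : ∀ {a} {A : Set a} {n} → Vector (A → A) n → A → A
∏ = foldr _∘′_ id

module Group {a q} (F : FiniteField a q) (ℓ t : ℕ) (t*ℓ≡q : t ℕ.* ℓ ≡ q) where
  open FiniteField F hiding (_^_)
  open Endo Carrier using (_^_)

  -- c[ i , j ] is c_{iℓ+j}, since  toℕ (combine i j) ≡ ℓ * toℕ i + toℕ j.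
  c[_,_] : Fin t → Fin ℓ → Carrier
  c[ i , j ] = to c (cast t*ℓ≡q (combine i j))

  α β : Carrier → Carrier
  α = ∏ λ (i : Fin t) → cycle _≟_ λ (j : Fin ℓ) → c[ i , j ]
  β = ∏ λ (j : Fin ℓ) → cycle _≟_ λ (i : Fin t) → c[ i , j ]

  g[_,_] : Fin ℓ → Fin t → Carrier → Carrier
  g[ i , j ] = (α ^ toℕ i) ∘′ (β ^ toℕ j)

  -- The entries of τ are exactly the elements of G = { αⁱ βʲ }.  Entries of a
  -- permutation polynomial tuple are pairwise distinct, so such a tuple lists
  -- each element of G once.
  ConsistsOfG : Vector (Carrier ↔ Carrier) q → Set a
  ConsistsOfG τ = (∀ k → ∃₂ λ i j → to (τ k) ≗ g[ i , j ])
                × (∀ i j → ∃ λ k → to (τ k) ≗ g[ i , j ])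

module _ (p r e : ℕ) .{{_ : NonZero p}} where

  private instance
    ℓ≢0 : NonZero (p ℕ.^ e)
    ℓ≢0 = ℕ.m^n≢0 p e

  ℓ t : ℕ
  ℓ = p ℕ.^ e
  t = p ℕ.^ r / ℓ

  ℓ∣q : e ℕ.< r → ℓ ∣ p ℕ.^ r
  ℓ∣q e<r = divides (p ℕ.^ (r ∸ e))
    (trans (cong (p ℕ.^_) (sym (ℕ.m∸n+n≡m (ℕ.<⇒≤ e<r))))
           (ℕ.^-distribˡ-+-* p (r ∸ e) e))

  t*ℓ≡q : e ℕ.< r → t ℕ.* ℓ ≡ p ℕ.^ r
  t*ℓ≡q e<r = m/n*n≡m (ℓ∣q e<r)

  IsKlenian : ∀ {a} → e ℕ.< r → (F : FiniteField a (p ℕ.^ r)) → Poly F → Set a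
  IsKlenian e<r F f =
    IsLPP F f ×
    ∃ λ τ → IsPermutationPolynomialTuple F τ
          × IsTupleOf F f τ
          × Group.ConsistsOfG F ℓ t (t*ℓ≡q e<r) τ

{-# OPTIONS --safe #-}

-- Identify c_{iℓ+j} with (i , j) ∈ ℤ/t × ℤ/ℓ.  Every element of G is then a
-- translation, so f(x , y) determines y - x.  If σ is an orthomorphism of
-- ℤ/t × ℤ/ℓ, that is, both σ and σ - id are bijective, then y - σ(x) is a
-- companion of f, since (y - x) - (y - σ(x)) = σ(x) - x determines x.  Such a σ
-- exists because t and ℓ are powers of 2 different from 1: it is explicit on
-- ℤ/2n × ℤ/2, and it extends from ℤ/n × ℤ/k to ℤ/2n × ℤ/2k because the kernel of
-- the reduction map is (ℤ/2)², which has an orthomorphism.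
module Submission where

open import Defs
open import Data.Nat using (ℕ; _≤_; _<_; _^_)
open import Data.Product using (∃)

import Algebra.Properties.AbelianGroup as AbelianGroupProperties
import Algebra.Properties.CommutativeSemigroup as CommutativeSemigroupProperties
import Algebra.Properties.Semiring.Sum as SemiringSum
import Algebra.Solver.Ring.NaturalCoefficients.Default as SemiringSolver
open import Algebra.Apartness.Structures using (IsHeytingField)
open import Algebra.Bundles using (CommutativeRing)
open import Data.Fin as Fin using (Fin; toℕ; fromℕ<; combine; remQuot; cast; punchOut)
import Data.Fin.Properties as Fin
open import Data.Integer.DivMod using (a≡a%ℕn+[a/ℕn]*n; n%ℕd<d)
open import Data.Integer.Divisibility.Signed as ℤ using (∣⇒∣ᵤ; ∣m∣n⇒∣m+n; ∣m⇒∣-m; ∣-trans)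
import Data.Integer.Properties as ℤ
open import Data.Integer.Tactic.RingSolver using (solve-∀)
open import Data.Nat as ℕ using (zero; suc; NonZero; _∸_)
import Data.Nat.Divisibility as ℕ
import Data.Nat.Properties as ℕ
open import Data.Product using (_×_; _,_; proj₁; proj₂; swap; uncurry)
open import Data.Product.Function.NonDependent.Propositional using (_×-↔_)
open import Data.Product.Properties using (,-injective)
open import Data.Vec.Functional using (Vector; head; tail)
open import Function using (_∘_; _∘′_; _↔_; Inverse; Injection; Injective; Bijective)
import Function.Endo.Propositional as Endo
open import Function.Properties.Inverse using (↔-sym; ↔-trans; ↔⇒↣)
open import Relation.Binary.Definitions using (DecidableEquality)
open import Relation.Binary.PropositionalEquality
  using (_≡_; _≢_; refl; sym; trans; cong; cong₂; subst; subst₂; module ≡-Reasoning)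
open import Relation.Nullary using (contradiction; yes; no)

open Inverse using (to; from; strictlyInverseˡ; strictlyInverseʳ)

-- Injections of a finite set into itself.

Fin-injective⇒surjective : ∀ {n} {f : Fin n → Fin n} → Injective _≡_ _≡_ f →
                           ∀ y → ∃ λ x → f x ≡ y
Fin-injective⇒surjective {suc n} {f} inj y with Fin.any? (λ x → f x Fin.≟ y)
... | yes hit = hit
-- If `y` were missed, punching it out of the codomain would inject `Fin (suc n)` into `Fin n`.
... | no miss = contradiction
  (Fin.injective⇒≤ {f = λ x → punchOut (y≢f x)} (inj ∘ Fin.punchOut-injective (y≢f _) (y≢f _)))
  ℕ.1+n≰n
  where
  y≢f : ∀ x → y ≢ f x
  y≢f x y≡fx = miss (x , sym y≡fx)

to-injective : ∀ {a b} {A : Set a} {B : Set b} (A↔B : A ↔ B) → Injective _≡_ _≡_ (to A↔B)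
to-injective A↔B = Injection.injective (↔⇒↣ A↔B)

injective⇒surjective : ∀ {a n} {A : Set a} {f : A → A} → Fin n ↔ A →
                       Injective _≡_ _≡_ f → ∀ y → ∃ λ x → f x ≡ y
injective⇒surjective {f = f} A↔ inj y
  with i , eq ← Fin-injective⇒surjective {f = from A↔ ∘ f ∘ to A↔}
         (to-injective A↔ ∘ inj ∘ to-injective (↔-sym A↔)) (from A↔ y)
  = to A↔ i , to-injective (↔-sym A↔) eq

injective⇒bijective : ∀ {a n} {A : Set a} {f : A → A} → Fin n ↔ A →
                      Injective _≡_ _≡_ f → Bijective _≡_ _≡_ f
injective⇒bijective A↔ inj = inj , λ y →
  let x , fx≡y = injective⇒surjective A↔ inj y in x , λ { refl → fx≡y }

-- Products of disjoint cycles.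

module _ {a} {A : Set a} (_≟_ : DecidableEquality A) where

  -- The search inside `cycle` may return any index holding the value `s k`; injectivity of `s`
  -- identifies that index with `k`.
  cycle-∈ : ∀ {n} (s : Vector A n) → Injective _≡_ _≡_ s →
            ∀ k → cycle _≟_ s (s k) ≡ s (next k)
  cycle-∈ s inj k with Fin.any? (λ k′ → s k′ ≟ s k)
  ... | yes (k′ , eq) = cong (s ∘ next) (inj eq)
  ... | no miss       = contradiction (k , refl) miss

  cycle-∉ : ∀ {n} (s : Vector A n) {x} → (∀ k → s k ≢ x) → cycle _≟_ s x ≡ x
  cycle-∉ s {x} x∉s with Fin.any? (λ k → s k ≟ x)
  ... | yes (k , eq) = contradiction eq (x∉s k)
  ... | no _         = refl

  ∏-cycle-∉ : ∀ {m n} (s : Vector (Vector A n) m) {x} → (∀ i k → s i k ≢ x) →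
              ∏ (λ i → cycle _≟_ (s i)) x ≡ x
  ∏-cycle-∉ {zero}  s x∉s = refl
  ∏-cycle-∉ {suc m} s x∉s =
    trans (cong (cycle _≟_ (head s)) (∏-cycle-∉ (tail s) (x∉s ∘ Fin.suc)))
          (cycle-∉ (head s) (x∉s Fin.zero))

  -- Only the factor containing `s i k` moves it: the factors to its right, applied earlier, fix the
  -- point, and those to its left fix the image, since both lie on the same cycle.
  ∏-cycle-∈ : ∀ {m n} (s : Vector (Vector A n) m) →
              (∀ {i i′ k k′} → s i k ≡ s i′ k′ → i ≡ i′ × k ≡ k′) →
              ∀ i k → ∏ (λ i → cycle _≟_ (s i)) (s i k) ≡ s i (next k)
  ∏-cycle-∈ s inj Fin.zero k =
    trans (cong (cycle _≟_ (head s)) (∏-cycle-∉ (tail s) λ i k′ eq →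
            contradiction (proj₁ (inj eq)) λ ()))
          (cycle-∈ (head s) (proj₂ ∘ inj) k)
  ∏-cycle-∈ s inj (Fin.suc i) k =
    trans (cong (cycle _≟_ (head s)) (∏-cycle-∈ (tail s)
            (λ eq → Fin.suc-injective (proj₁ (inj eq)) , proj₂ (inj eq)) i k))
          (cycle-∉ (head s) λ k′ eq → contradiction (proj₁ (inj eq)) λ ())

-- Interpolation over a finite field

module Interpolation {a q} (F : FiniteField a q) where
  open FiniteField F using (Carrier; c; isField; commutativeRing; sum-syntax) renaming (_^_ to _^ᶠ_)
  open IsHeytingField isField using (#⇒invertible)
  open CommutativeRing commutativeRing hiding (refl; sym; trans; Carrier; _≈_)
  open SemiringSum semiring using (sum-cong-≗; *-distribˡ-sum; *-distribʳ-sum)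
  open CommutativeSemigroupProperties *-commutativeSemigroup using (x∙yz≈y∙xz; xy∙z≈xz∙y)
  open SemiringSolver commutativeSemiring using (solve; _:=_; _:+_; _:*_)
  open AbelianGroupProperties +-abelianGroup using (xyx⁻¹≈y)
  open ≡-Reasoning

  eval₁ : ∀ {n} → Vector Carrier n → Carrier → Carrier
  eval₁ {n} p x = ∑[ i < n ] (p i * x ^ᶠ toℕ i)

  eval₁-∷ : ∀ {n} (p : Vector Carrier (suc n)) x →
            eval₁ p x ≡ head p + x * eval₁ (tail p) x
  eval₁-∷ p x = cong₂ _+_ (*-identityʳ (head p)) (begin
    ∑[ i < _ ] (tail p i * (x * x ^ᶠ toℕ i))  ≡⟨ sum-cong-≗ (λ i → x∙yz≈y∙xz (tail p i) x (x ^ᶠ toℕ i)) ⟩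
    ∑[ i < _ ] (x * (tail p i * x ^ᶠ toℕ i))  ≡⟨ *-distribˡ-sum x (λ i → tail p i * x ^ᶠ toℕ i) ⟨
    x * eval₁ (tail p) x                      ∎)

  -- The coefficients of v + (X - s) p, by Horner's scheme.
  _+[X-_]*_ : ∀ {n} → Carrier → Carrier → Vector Carrier n → Vector Carrier (suc n)
  _+[X-_]*_ {zero}  v s p _           = v
  _+[X-_]*_ {suc n} v s p Fin.zero    = v + - s * head p
  _+[X-_]*_ {suc n} v s p (Fin.suc i) = (head p +[X- s ]* tail p) i

  eval₁-+[X-]* : ∀ {n} v s (p : Vector Carrier n) x →
                 eval₁ (v +[X- s ]* p) x ≡ v + (x - s) * eval₁ p x
  eval₁-+[X-]* {zero}  v s p x = begin
    v * 1# + 0#        ≡⟨ cong (_+ 0#) (*-identityʳ v) ⟩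
    v + 0#             ≡⟨ cong (_+_ v) (zeroʳ (x - s)) ⟨
    v + (x - s) * 0#   ∎
  eval₁-+[X-]* {suc n} v s p x = begin
    eval₁ (v +[X- s ]* p) x
      ≡⟨ eval₁-∷ (v +[X- s ]* p) x ⟩
    v + - s * head p + x * eval₁ (head p +[X- s ]* tail p) x
      ≡⟨ cong (λ z → v + - s * head p + x * z) (eval₁-+[X-]* (head p) s (tail p) x) ⟩
    v + - s * head p + x * (head p + (x - s) * eval₁ (tail p) x)
      ≡⟨ solve 5 (λ v s h x t → v :+ s :* h :+ x :* (h :+ (x :+ s) :* t)
                              := v :+ (x :+ s) :* (h :+ x :* t))
           refl v (- s) (head p) x (eval₁ (tail p) x) ⟩
    v + (x - s) * (head p + x * eval₁ (tail p) x)
      ≡⟨ cong (λ z → v + (x - s) * z) (eval₁-∷ p x) ⟨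
    v + (x - s) * eval₁ p x ∎

  -- Newton interpolation: the result is v₀ + (X - s₀) p, where `p` interpolates the divided
  -- differences (vᵢ - v₀) / (sᵢ - s₀) at the remaining nodes. Each node adds one coefficient, so
  -- `n` nodes give degree below `n`.
  interpolate : ∀ {n} (s v : Vector Carrier n) → Injective _≡_ _≡_ s →
                ∃ λ (p : Vector Carrier n) → ∀ i → eval₁ p (s i) ≡ v i
  interpolate {zero}  s v inj = (λ ()) , λ ()
  interpolate {suc n} s v inj = v₀ +[X- s₀ ]* p , eval-at
    where
    s₀ v₀ : Carrier
    s₀ = head s
    v₀ = head v

    invertible : ∀ i → ∃ λ z → z * (tail s i - s₀) ≡ 1# × (tail s i - s₀) * z ≡ 1#
    invertible i = #⇒invertible λ eq → contradiction (inj eq) λ ()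

    slope : Vector Carrier n
    slope i = proj₁ (invertible i) * (tail v i - v₀)

    p,p-at = interpolate (tail s) slope (Fin.suc-injective ∘ inj)
    p = proj₁ p,p-at
    p-at = proj₂ p,p-at

    eval-at : ∀ i → eval₁ (v₀ +[X- s₀ ]* p) (s i) ≡ v i
    eval-at Fin.zero = begin
      eval₁ (v₀ +[X- s₀ ]* p) s₀        ≡⟨ eval₁-+[X-]* v₀ s₀ p s₀ ⟩
      v₀ + (s₀ - s₀) * eval₁ p s₀       ≡⟨ cong (λ z → v₀ + z * eval₁ p s₀) (-‿inverseʳ s₀) ⟩
      v₀ + 0# * eval₁ p s₀              ≡⟨ cong (_+_ v₀) (zeroˡ (eval₁ p s₀)) ⟩
      v₀ + 0#                           ≡⟨ +-identityʳ v₀ ⟩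
      v₀                                ∎
    eval-at (Fin.suc i) = begin
      eval₁ (v₀ +[X- s₀ ]* p) sᵢ        ≡⟨ eval₁-+[X-]* v₀ s₀ p sᵢ ⟩
      v₀ + (sᵢ - s₀) * eval₁ p sᵢ       ≡⟨ cong (λ z → v₀ + (sᵢ - s₀) * z) (p-at i) ⟩
      v₀ + (sᵢ - s₀) * (z * (vᵢ - v₀))  ≡⟨ cong (_+_ v₀) (*-assoc (sᵢ - s₀) z (vᵢ - v₀)) ⟨
      v₀ + (sᵢ - s₀) * z * (vᵢ - v₀)    ≡⟨ cong (λ w → v₀ + w * (vᵢ - v₀)) (proj₂ (proj₂ (invertible i))) ⟩
      v₀ + 1# * (vᵢ - v₀)               ≡⟨ cong (_+_ v₀) (*-identityˡ (vᵢ - v₀)) ⟩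
      v₀ + (vᵢ - v₀)                    ≡⟨ +-assoc v₀ vᵢ (- v₀) ⟨
      v₀ + vᵢ - v₀                      ≡⟨ xyx⁻¹≈y v₀ vᵢ ⟩
      vᵢ                                ∎
      where
      sᵢ = tail s i
      vᵢ = tail v i
      z = proj₁ (invertible i)

  represent₁ : (h : Carrier → Carrier) → ∃ λ (p : Vector Carrier q) → ∀ x → eval₁ p x ≡ h x
  represent₁ h = let p , p-at = interpolate (to c) (h ∘ to c) (to-injective c) in
    p , λ x → subst (λ x → eval₁ p x ≡ h x) (strictlyInverseˡ c x) (p-at (from c x))

  -- One-variable interpolation is used twice: for each `y`, the function `x ↦ h x y` has a
  -- coefficient vector `w y`, and then each coefficient `w y i` is interpolated as a function of
  -- `y`.
  represent : (h : Carrier → Carrier → Carrier) → ∃ λ (f : Poly F) → ∀ x y → eval F f x y ≡ h x y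
  represent h = f , λ x y → begin
    eval F f x y
      ≡⟨ sum-cong-≗ (λ i → trans
           (sum-cong-≗ λ j → xy∙z≈xz∙y (f i j) (x ^ᶠ toℕ i) (y ^ᶠ toℕ j))
           (sym (*-distribʳ-sum (x ^ᶠ toℕ i) (λ j → f i j * y ^ᶠ toℕ j)))) ⟩
    ∑[ i < q ] (eval₁ (f i) y * x ^ᶠ toℕ i)
      ≡⟨ sum-cong-≗ (λ i → cong (_* x ^ᶠ toℕ i) (proj₂ (represent₁ (λ y → w y i)) y)) ⟩
    eval₁ (w y) x
      ≡⟨ proj₂ (represent₁ (λ x → h x y)) x ⟩
    h x y ∎
    where
    w : Carrier → Vector Carrier q
    w y = proj₁ (represent₁ (λ x → h x y))

    f : Poly F
    f i = proj₁ (represent₁ (λ y → w y i))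

open import Data.Integer as ℤ using (ℤ; +_; _+_; _-_; -_; _*_; _%ℕ_; _/ℕ_)

-- Congruences

infix 4 _≡_[mod_]

-- A record, so that unification can recover `a`, `b` and `n`, which the difference `a - b` alone
-- would not reveal.
record _≡_[mod_] (a b : ℤ) (n : ℕ) : Set where
  constructor ∣⇒mod
  field mod⇒∣ : + n ℤ.∣ a - b
open _≡_[mod_]

module _ {n : ℕ} where

  mod-reflexive : ∀ {a b} → a ≡ b → a ≡ b [mod n ]
  mod-reflexive {a} refl = ∣⇒mod (ℤ.divides (+ 0) (ℤ.+-inverseʳ a))

  mod-sym : ∀ {a b} → a ≡ b [mod n ] → b ≡ a [mod n ]
  mod-sym {a} {b} p = ∣⇒mod (subst (+ n ℤ.∣_) (eq a b) (∣m⇒∣-m (mod⇒∣ p)))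
    where
    eq : ∀ a b → - (a - b) ≡ b - a
    eq = solve-∀

  mod-trans : ∀ {a b c} → a ≡ b [mod n ] → b ≡ c [mod n ] → a ≡ c [mod n ]
  mod-trans {a} {b} {c} p q =
    ∣⇒mod (subst (+ n ℤ.∣_) (eq a b c) (∣m∣n⇒∣m+n (mod⇒∣ p) (mod⇒∣ q)))
    where
    eq : ∀ a b c → a - b + (b - c) ≡ a - c
    eq = solve-∀

  mod-+ : ∀ {a b c d} → a ≡ b [mod n ] → c ≡ d [mod n ] → a + c ≡ b + d [mod n ]
  mod-+ {a} {b} {c} {d} p q =
    ∣⇒mod (subst (+ n ℤ.∣_) (eq a b c d) (∣m∣n⇒∣m+n (mod⇒∣ p) (mod⇒∣ q)))
    where
    eq : ∀ a b c d → a - b + (c - d) ≡ a + c - (b + d)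
    eq = solve-∀

  mod-neg : ∀ {a b} → a ≡ b [mod n ] → - a ≡ - b [mod n ]
  mod-neg {a} {b} p = ∣⇒mod (subst (+ n ℤ.∣_) (eq a b) (∣m⇒∣-m (mod⇒∣ p)))
    where
    eq : ∀ a b → - (a - b) ≡ - a - - b
    eq = solve-∀

  mod-- : ∀ {a b c d} → a ≡ b [mod n ] → c ≡ d [mod n ] → a - c ≡ b - d [mod n ]
  mod-- p q = mod-+ p (mod-neg q)

  mod-cancelʳ : ∀ {a b c d} → a + c ≡ b + d [mod n ] → c ≡ d [mod n ] → a ≡ b [mod n ]
  mod-cancelʳ {a} {b} {c} {d} p q =
    subst₂ (_≡_[mod n ]) (eq a c) (eq b d) (mod-- p q)
    where
    eq : ∀ a c → a + c - c ≡ a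
    eq = solve-∀

  -- The difference is a multiple of `n` with absolute value at most the larger of `r` and `s`,
  -- hence below `n`, so it is zero.
  mod⇒≡ : ∀ {r s} → r < n → s < n → + r ≡ + s [mod n ] → r ≡ s
  mod⇒≡ {r} {s} r<n s<n p =
    ℤ.+-injective (ℤ.i-j≡0⇒i≡j (+ r) (+ s) (ℤ.∣i∣≡0⇒i≡0 ∣r-s∣≡0))
    where
    ∣r-s∣<n : ℤ.∣ + r - + s ∣ < n
    ∣r-s∣<n = ℕ.≤-<-trans
      (ℕ.≤-trans (ℕ.≤-reflexive (cong ℤ.∣_∣ (ℤ.m-n≡m⊖n r s))) (ℤ.∣m⊝n∣≤m⊔n r s))
      (ℕ.⊔-lub r<n s<n)

    ∣r-s∣≡0 : ℤ.∣ + r - + s ∣ ≡ 0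
    ∣r-s∣≡0 with ℤ.∣ + r - + s ∣ | ∣r-s∣<n | ∣⇒∣ᵤ (mod⇒∣ p)
    ... | zero  | _   | _   = refl
    ... | suc _ | d<n | n∣d = contradiction n∣d (ℕ.>⇒∤ d<n)

  module _ .{{_ : NonZero n}} where

    %-≡-mod : ∀ a → + (a %ℕ n) ≡ a [mod n ]
    %-≡-mod a = ∣⇒mod (ℤ.divides (- (a /ℕ n)) (begin
      + r - a                ≡⟨ cong (λ z → + r - z) (a≡a%ℕn+[a/ℕn]*n a n) ⟩
      + r - (+ r + q * + n)  ≡⟨ eq (+ r) q (+ n) ⟩
      - q * + n              ∎))
      where
      open ≡-Reasoning
      r = a %ℕ n
      q = a /ℕ n
      eq : ∀ r q n → r - (r + q * n) ≡ - q * n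
      eq = solve-∀

    mod⇒%≡ : ∀ {a b} → a ≡ b [mod n ] → a %ℕ n ≡ b %ℕ n
    mod⇒%≡ {a} {b} p = mod⇒≡ (n%ℕd<d a n) (n%ℕd<d b n)
      (mod-trans (%-≡-mod a) (mod-trans p (mod-sym (%-≡-mod b))))

toℕ-next : ∀ {n} (k : Fin n) → + toℕ (next k) ≡ + toℕ k + + 1 [mod n ]
toℕ-next {suc n} k = subst (_≡ + toℕ k + + 1 [mod suc n ])
  (cong +_ (sym (Fin.toℕ-fromℕ< _)))
  (mod-trans (%-≡-mod (+ suc (toℕ k))) (mod-reflexive (ℤ.+-comm (+ 1) (+ toℕ k))))

mod-∣ : ∀ {m n a b} → + m ℤ.∣ + n → a ≡ b [mod n ] → a ≡ b [mod m ]
mod-∣ m∣n p = ∣⇒mod (∣-trans m∣n (mod⇒∣ p))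

-- Passing between the moduli 2n, n and 2.

module _ {n : ℕ} where

  mod-2n⇒mod-n : ∀ {a b} → a ≡ b [mod 2 ℕ.* n ] → a ≡ b [mod n ]
  mod-2n⇒mod-n = mod-∣ (ℤ.divides (+ 2) (ℤ.pos-* 2 n))

  mod-2n⇒mod-2 : ∀ {a b} → a ≡ b [mod 2 ℕ.* n ] → a ≡ b [mod 2 ]
  mod-2n⇒mod-2 = mod-∣ (ℤ.divides (+ n) (trans (ℤ.pos-* 2 n) (ℤ.*-comm (+ 2) (+ n))))

  -- Multiplication by `n` identifies ℤ/2 with the kernel of ℤ/2n → ℤ/n. This is its
  -- well-definedness; `*-mod-2n⇒mod-2` is its injectivity.
  *-mod-2⇒mod-2n : ∀ {a b} → a ≡ b [mod 2 ] → + n * a ≡ + n * b [mod 2 ℕ.* n ]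
  *-mod-2⇒mod-2n {a} {b} (∣⇒mod (ℤ.divides k eq)) = ∣⇒mod (ℤ.divides k (begin
    + n * a - + n * b   ≡⟨ eq₁ (+ n) a b ⟩
    + n * (a - b)       ≡⟨ cong (+ n *_) eq ⟩
    + n * (k * + 2)     ≡⟨ eq₂ (+ n) k ⟩
    k * (+ 2 * + n)     ≡⟨ cong (k *_) (ℤ.pos-* 2 n) ⟨
    k * + (2 ℕ.* n)     ∎))
    where
    open ≡-Reasoning
    eq₁ : ∀ n a b → n * a - n * b ≡ n * (a - b)
    eq₁ = solve-∀
    eq₂ : ∀ n k → n * (k * + 2) ≡ k * (+ 2 * n)
    eq₂ = solve-∀

  *-mod-2n⇒mod-2 : ∀ {a b} .{{_ : NonZero n}} →
                   + n * a ≡ + n * b [mod 2 ℕ.* n ] → a ≡ b [mod 2 ]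
  *-mod-2n⇒mod-2 {a} {b} {{n≢0}} (∣⇒mod (ℤ.divides k eq)) = ∣⇒mod (ℤ.divides k
    (ℤ.*-cancelʳ-≡ (a - b) (k * + 2) (+ n) {{n≢0}} (begin
    (a - b) * + n       ≡⟨ eq₁ (+ n) a b ⟩
    + n * a - + n * b   ≡⟨ eq ⟩
    k * + (2 ℕ.* n)     ≡⟨ cong (k *_) (ℤ.pos-* 2 n) ⟩
    k * (+ 2 * + n)     ≡⟨ ℤ.*-assoc k (+ 2) (+ n) ⟨
    k * + 2 * + n       ∎)))
    where
    open ≡-Reasoning
    eq₁ : ∀ n a b → (a - b) * n ≡ n * a - n * b
    eq₁ = solve-∀

  2*-mod-2n⇒mod-n : ∀ {a b} → + 2 * a ≡ + 2 * b [mod 2 ℕ.* n ] → a ≡ b [mod n ]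
  2*-mod-2n⇒mod-n {a} {b} (∣⇒mod (ℤ.divides k eq)) = ∣⇒mod (ℤ.divides k
    (ℤ.*-cancelˡ-≡ (+ 2) (a - b) (k * + n) (begin
    + 2 * (a - b)       ≡⟨ eq₁ a b ⟩
    + 2 * a - + 2 * b   ≡⟨ eq ⟩
    k * + (2 ℕ.* n)     ≡⟨ cong (k *_) (ℤ.pos-* 2 n) ⟩
    k * (+ 2 * + n)     ≡⟨ eq₂ (+ n) k ⟩
    + 2 * (k * + n)     ∎)))
    where
    open ≡-Reasoning
    eq₁ : ∀ a b → + 2 * (a - b) ≡ + 2 * a - + 2 * b
    eq₁ = solve-∀
    eq₂ : ∀ n k → k * (+ 2 * n) ≡ + 2 * (k * n)
    eq₂ = solve-∀

  module _ .{{_ : NonZero n}} where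

    divMod : ∀ a → a ≡ + n * (a /ℕ n) + + (a %ℕ n)
    divMod a = trans (a≡a%ℕn+[a/ℕn]*n a n) (eq (+ n) (a /ℕ n) (+ (a %ℕ n)))
      where
      eq : ∀ n q r → r + q * n ≡ n * q + r
      eq = solve-∀

    -- With `/-mod-2⇒mod-2n`, this describes a class modulo 2n by its residue modulo `n` and the
    -- parity of its quotient by `n`. Equal residues cancel in `divMod`, leaving `n` times the
    -- quotients.
    mod-2n⇒/-mod-2 : ∀ {a b} → a ≡ b [mod 2 ℕ.* n ] → a /ℕ n ≡ b /ℕ n [mod 2 ]
    mod-2n⇒/-mod-2 {a} {b} p = *-mod-2n⇒mod-2
      (mod-cancelʳ (subst₂ (_≡_[mod 2 ℕ.* n ]) (divMod a) (divMod b) p)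
        (mod-reflexive (cong +_ (mod⇒%≡ (mod-2n⇒mod-n p)))))

    /-mod-2⇒mod-2n : ∀ {a b} → a ≡ b [mod n ] → a /ℕ n ≡ b /ℕ n [mod 2 ] →
                     a ≡ b [mod 2 ℕ.* n ]
    /-mod-2⇒mod-2n {a} {b} p q =
      subst₂ (_≡_[mod 2 ℕ.* n ]) (sym (divMod a)) (sym (divMod b))
        (mod-+ (*-mod-2⇒mod-2n q) (mod-reflexive (cong +_ (mod⇒%≡ p))))

-- Congruence of pairs of integers.

ℤ² : Set
ℤ² = ℤ × ℤ

infixl 6 _⊝_

_⊝_ : ℤ² → ℤ² → ℤ²
(a , b) ⊝ (a′ , b′) = (a - a′ , b - b′)

infix 4 _≡_[mod²_,_]

record _≡_[mod²_,_] (u v : ℤ²) (n k : ℕ) : Set where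
  constructor _,_
  field
    mod₁ : proj₁ u ≡ proj₁ v [mod n ]
    mod₂ : proj₂ u ≡ proj₂ v [mod k ]
open _≡_[mod²_,_]

mod²-sym : ∀ {u v n k} → u ≡ v [mod² n , k ] → v ≡ u [mod² n , k ]
mod²-sym (p , q) = mod-sym p , mod-sym q

mod²-trans : ∀ {u v w n k} → u ≡ v [mod² n , k ] → v ≡ w [mod² n , k ] → u ≡ w [mod² n , k ]
mod²-trans (p₁ , p₂) (q₁ , q₂) = mod-trans p₁ q₁ , mod-trans p₂ q₂

mod²-swap : ∀ {u v n k} → u ≡ v [mod² n , k ] → swap u ≡ swap v [mod² k , n ]
mod²-swap (p , q) = q , p

⊝-cancelˡ : ∀ {n k} w u v → w ⊝ u ≡ w ⊝ v [mod² n , k ] → u ≡ v [mod² n , k ]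
⊝-cancelˡ (w₁ , w₂) (u₁ , u₂) (v₁ , v₂) (p₁ , p₂) = cancel w₁ u₁ v₁ p₁ , cancel w₂ u₂ v₂ p₂
  where
  cancel : ∀ {n} c a b → c - a ≡ c - b [mod n ] → a ≡ b [mod n ]
  cancel {n} c a b p =
    subst₂ (_≡_[mod n ]) (eq c a) (eq c b) (mod-- (mod-reflexive (refl {x = c})) p)
    where
    eq : ∀ c a → c - (c - a) ≡ a
    eq = solve-∀

⊝-cancelʳ : ∀ {n k} w u v → u ⊝ w ≡ v ⊝ w [mod² n , k ] → u ≡ v [mod² n , k ]
⊝-cancelʳ (w₁ , w₂) (u₁ , u₂) (v₁ , v₂) (p₁ , p₂) = cancel w₁ u₁ v₁ p₁ , cancel w₂ u₂ v₂ p₂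
  where
  cancel : ∀ {n} c a b → a - c ≡ b - c [mod n ] → a ≡ b [mod n ]
  cancel c a b p = mod-cancelʳ {a = a} {b} { - c} { - c} p (mod-reflexive refl)

-- This is w - v = (u - v) - (u - w). With u = y, v = x and w = σ(x) it eliminates `y` from the
-- values of the two polynomials and leaves σ(x) - x.
⊝-⊝ : ∀ {n k} u v w u′ v′ w′ → u ⊝ v ≡ u′ ⊝ v′ [mod² n , k ] →
      u ⊝ w ≡ u′ ⊝ w′ [mod² n , k ] → w ⊝ v ≡ w′ ⊝ v′ [mod² n , k ]
⊝-⊝ (u₁ , u₂) (v₁ , v₂) (w₁ , w₂) (u₁′ , u₂′) (v₁′ , v₂′) (w₁′ , w₂′) (p₁ , p₂) (q₁ , q₂) =
  diff u₁ v₁ w₁ u₁′ v₁′ w₁′ p₁ q₁ , diff u₂ v₂ w₂ u₂′ v₂′ w₂′ p₂ q₂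
  where
  diff : ∀ {n} a b c a′ b′ c′ → a - b ≡ a′ - b′ [mod n ] → a - c ≡ a′ - c′ [mod n ] →
         c - b ≡ c′ - b′ [mod n ]
  diff {n} a b c a′ b′ c′ p q =
    subst₂ (_≡_[mod n ]) (eq a b c) (eq a′ b′ c′) (mod-- p q)
    where
    eq : ∀ a b c → a - b - (a - c) ≡ c - b
    eq = solve-∀

-- Orthomorphisms of ℤ/n × ℤ/k

-- σ need not respect the congruence: it is only ever applied to one
-- representative of each class.
record Orthomorphism (n k : ℕ) : Set where
  field
    σ     : ℤ² → ℤ²
    σ-inj : ∀ u v → σ u ≡ σ v [mod² n , k ] → u ≡ v [mod² n , k ]
    δ-inj : ∀ u v → σ u ⊝ u ≡ σ v ⊝ v [mod² n , k ] → u ≡ v [mod² n , k ]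

orthomorphism-swap : ∀ {n k} → Orthomorphism n k → Orthomorphism k n
orthomorphism-swap θ = record
  { σ     = λ u → swap (σ (swap u))
  ; σ-inj = λ u v p → mod²-swap (σ-inj (swap u) (swap v) (mod²-swap p))
  ; δ-inj = λ u v p → mod²-swap (δ-inj (swap u) (swap v) (mod²-swap p))
  }
  where open Orthomorphism θ

-- On ℤ/2n × ℤ/2 with ε ∈ {0, 1} and d = i + ε, take σ (i , ε) = (i + d , [d ≥ n]),
-- whose difference with the identity is (d , [d ≥ n] - ε).
orthomorphism-2n×2 : ∀ n .{{_ : NonZero n}} → Orthomorphism (2 ℕ.* n) 2
orthomorphism-2n×2 n = record
  -- The second coordinate is read modulo 2, and the parity of `d u /ℕ n` is 1 exactly when the
  -- representative of `d u` in {0, ..., 2n - 1} is at least `n`.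
  { σ     = λ u → proj₁ u + d u , d u /ℕ n
  ; σ-inj = λ { u v (p , q) → σ-inj u v p q }
  ; δ-inj = λ { u v (p , q) → δ-inj u v p q }
  }
  where
  e : ℤ² → ℤ
  e (_ , ε) = + (ε %ℕ 2)

  d : ℤ² → ℤ
  d u = proj₁ u + e u

  σ-inj : ∀ u v → proj₁ u + d u ≡ proj₁ v + d v [mod 2 ℕ.* n ] →
          d u /ℕ n ≡ d v /ℕ n [mod 2 ] → u ≡ v [mod² 2 ℕ.* n , 2 ]
  σ-inj u@(i , ε) v@(j , η) p q = mod-cancelʳ du≡dv (mod-reflexive eu≡ev) , ε≡η
    where
    2i+e : ∀ i e → i + (i + e) ≡ + 2 * i + e
    2i+e = solve-∀

    p′ : + 2 * i + e u ≡ + 2 * j + e v [mod 2 ℕ.* n ]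
    p′ = subst₂ (_≡_[mod 2 ℕ.* n ]) (2i+e i (e u)) (2i+e j (e v)) p

    2i≡2j : + 2 * i ≡ + 2 * j [mod 2 ]
    2i≡2j = ∣⇒mod (ℤ.divides (i - j) (eq i j))
      where
      eq : ∀ i j → + 2 * i - + 2 * j ≡ (i - j) * + 2
      eq = solve-∀

    -- The first coordinate is 2i + ε, so its parity recovers ε.
    ε≡η : ε ≡ η [mod 2 ]
    ε≡η = mod-trans (mod-sym (%-≡-mod ε)) (mod-trans
      (mod-cancelʳ (subst₂ (_≡_[mod 2 ]) (ℤ.+-comm (+ 2 * i) (e u)) (ℤ.+-comm (+ 2 * j) (e v))
        (mod-2n⇒mod-2 {n} p′)) 2i≡2j)
      (%-≡-mod η))

    eu≡ev : e u ≡ e v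
    eu≡ev = cong +_ (mod⇒%≡ ε≡η)

    -- Once ε is known, 2i modulo 2n gives i, hence `d`, modulo `n`; the second coordinate supplies
    -- the missing parity of the quotient.
    du≡dv : d u ≡ d v [mod 2 ℕ.* n ]
    du≡dv = /-mod-2⇒mod-2n
      (mod-+ (2*-mod-2n⇒mod-n {a = i} {j} (mod-cancelʳ p′ (mod-reflexive eu≡ev))) (mod-reflexive eu≡ev)) q

  δ-inj : ∀ u v → proj₁ u + d u - proj₁ u ≡ proj₁ v + d v - proj₁ v [mod 2 ℕ.* n ] →
          d u /ℕ n - proj₂ u ≡ d v /ℕ n - proj₂ v [mod 2 ] → u ≡ v [mod² 2 ℕ.* n , 2 ]
  δ-inj u@(i , ε) v@(j , η) p q =
    mod-cancelʳ du≡dv (mod-reflexive (cong +_ (mod⇒%≡ ε≡η))) , ε≡η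
    where
    du≡dv : d u ≡ d v [mod 2 ℕ.* n ]
    du≡dv = subst₂ (_≡_[mod 2 ℕ.* n ]) (eq i (d u)) (eq j (d v)) p
      where
      eq : ∀ i d → i + d - i ≡ d
      eq = solve-∀

    -- Now `d` is known modulo 2n and with it the parity of `d /ℕ n`; subtracting the second
    -- coordinate leaves ε.
    ε≡η : ε ≡ η [mod 2 ]
    ε≡η = subst₂ (_≡_[mod 2 ]) (eq (d u /ℕ n) ε) (eq (d v /ℕ n) η)
      (mod-- (mod-2n⇒/-mod-2 {n} du≡dv) q)
      where
      eq : ∀ s ε → s - (s - ε) ≡ ε
      eq = solve-∀

-- The subgroup (nℤ/2n) × (kℤ/2k) is (ℤ/2)², on which (h₁ , h₂) ↦ (h₂ , h₁ + h₂)
-- is an orthomorphism; it is combined with θ on the quotient.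
orthomorphism-double : ∀ n k .{{_ : NonZero n}} .{{_ : NonZero k}} →
                       Orthomorphism n k → Orthomorphism (2 ℕ.* n) (2 ℕ.* k)
orthomorphism-double n k θ = record
  { σ     = λ u → + n * (proj₂ u /ℕ k) + proj₁ (σ (rep u))
                , + k * (proj₁ u /ℕ n + proj₂ u /ℕ k) + proj₂ (σ (rep u))
  ; σ-inj = λ { u v (p , q) → inj u v p q }
  ; δ-inj = λ { u v (p , q) → δinj u v p q }
  }
  where
  open Orthomorphism θ

  rep : ℤ² → ℤ²
  rep (x , y) = + (x %ℕ n) , + (y %ℕ k)

  unrep : ∀ {u v} → rep u ≡ rep v [mod² n , k ] → u ≡ v [mod² n , k ]
  unrep {x , y} {x′ , y′} (p , q) =
    mod-trans (mod-sym (%-≡-mod x)) (mod-trans p (%-≡-mod x′)) ,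
    mod-trans (mod-sym (%-≡-mod y)) (mod-trans q (%-≡-mod y′))

  -- Congruent pairs have identical representatives, so the values of `σ` there are equal and can be
  -- cancelled.
  rep-cong : ∀ {u v} → u ≡ v [mod² n , k ] → rep u ≡ rep v
  rep-cong (p , q) = cong₂ (λ r s → + r , + s) (mod⇒%≡ p) (mod⇒%≡ q)

  -- The kernel term `+ n * h` vanishes modulo `n`, which leaves only the contribution of `θ`.
  drop : ∀ {n} h h′ {a b} → + n * h + a ≡ + n * h′ + b [mod 2 ℕ.* n ] → a ≡ b [mod n ]
  drop {n} h h′ {a} {b} p = mod-cancelʳ
    (subst₂ (_≡_[mod n ]) (ℤ.+-comm (+ n * h) a) (ℤ.+-comm (+ n * h′) b) (mod-2n⇒mod-n p))
    (∣⇒mod (ℤ.divides (h - h′) (eq (+ n) h h′)))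
    where
    eq : ∀ n h h′ → n * h - n * h′ ≡ (h - h′) * n
    eq = solve-∀

  inj : ∀ u v → + n * (proj₂ u /ℕ k) + proj₁ (σ (rep u))
                ≡ + n * (proj₂ v /ℕ k) + proj₁ (σ (rep v)) [mod 2 ℕ.* n ] →
                + k * (proj₁ u /ℕ n + proj₂ u /ℕ k) + proj₂ (σ (rep u))
                ≡ + k * (proj₁ v /ℕ n + proj₂ v /ℕ k) + proj₂ (σ (rep v)) [mod 2 ℕ.* k ] →
                u ≡ v [mod² 2 ℕ.* n , 2 ℕ.* k ]
  inj u@(x , y) v@(x′ , y′) p q =
    /-mod-2⇒mod-2n (mod₁ u≡v) h₁ , /-mod-2⇒mod-2n (mod₂ u≡v) h₂
    where
    u≡v : u ≡ v [mod² n , k ]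
    u≡v = unrep (σ-inj (rep u) (rep v)
      (drop (y /ℕ k) (y′ /ℕ k) p , drop (x /ℕ n + y /ℕ k) (x′ /ℕ n + y′ /ℕ k) q))

    σu≡σv : σ (rep u) ≡ σ (rep v)
    σu≡σv = cong σ (rep-cong u≡v)

    -- Both pairs now have the same value of `σ ∘ rep`, so the kernel parts agree: the first
    -- coordinate gives h₂ and the second gives h₁ + h₂.
    h₂ : y /ℕ k ≡ y′ /ℕ k [mod 2 ]
    h₂ = *-mod-2n⇒mod-2 {n} (mod-cancelʳ p (mod-reflexive (cong proj₁ σu≡σv)))

    h₁ : x /ℕ n ≡ x′ /ℕ n [mod 2 ]
    h₁ = mod-cancelʳ (*-mod-2n⇒mod-2 {k} (mod-cancelʳ q (mod-reflexive (cong proj₂ σu≡σv)))) h₂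

  δinj : ∀ u v → + n * (proj₂ u /ℕ k) + proj₁ (σ (rep u)) - proj₁ u
                 ≡ + n * (proj₂ v /ℕ k) + proj₁ (σ (rep v)) - proj₁ v [mod 2 ℕ.* n ] →
                 + k * (proj₁ u /ℕ n + proj₂ u /ℕ k) + proj₂ (σ (rep u)) - proj₂ u
                 ≡ + k * (proj₁ v /ℕ n + proj₂ v /ℕ k) + proj₂ (σ (rep v)) - proj₂ v [mod 2 ℕ.* k ] →
                 u ≡ v [mod² 2 ℕ.* n , 2 ℕ.* k ]
  δinj u@(x , y) v@(x′ , y′) p q =
    /-mod-2⇒mod-2n (mod₁ u≡v) h₁ , /-mod-2⇒mod-2n (mod₂ u≡v) h₂
    where
    -- Splitting `x` into quotient and remainder separates the difference with the identity into a
    -- kernel part and the corresponding difference for `θ`.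
    regroup : ∀ {n} .{{_ : NonZero n}} a s x →
              + n * a + s - x ≡ + n * (a - x /ℕ n) + (s - + (x %ℕ n))
    regroup {n} a s x = trans (cong (λ z → + n * a + s - z) (divMod {n} x))
      (eq (+ n) a s (x /ℕ n) (+ (x %ℕ n)))
      where
      eq : ∀ n a s b r → n * a + s - (n * b + r) ≡ n * (a - b) + (s - r)
      eq = solve-∀

    p′ : + n * (y /ℕ k - x /ℕ n) + (proj₁ (σ (rep u)) - + (x %ℕ n))
         ≡ + n * (y′ /ℕ k - x′ /ℕ n) + (proj₁ (σ (rep v)) - + (x′ %ℕ n)) [mod 2 ℕ.* n ]
    p′ = subst₂ (_≡_[mod 2 ℕ.* n ]) (regroup _ _ x) (regroup _ _ x′) p

    q′ : + k * (x /ℕ n + y /ℕ k - y /ℕ k) + (proj₂ (σ (rep u)) - + (y %ℕ k))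
         ≡ + k * (x′ /ℕ n + y′ /ℕ k - y′ /ℕ k) + (proj₂ (σ (rep v)) - + (y′ %ℕ k)) [mod 2 ℕ.* k ]
    q′ = subst₂ (_≡_[mod 2 ℕ.* k ]) (regroup _ _ y) (regroup _ _ y′) q

    u≡v : u ≡ v [mod² n , k ]
    u≡v = unrep (δ-inj (rep u) (rep v) (drop _ _ p′ , drop _ _ q′))

    σ-rep≡ : σ (rep u) ⊝ rep u ≡ σ (rep v) ⊝ rep v
    σ-rep≡ = cong (λ w → σ w ⊝ w) (rep-cong u≡v)

    -- The kernel part of the difference is (h₂ - h₁ , h₁), so h₁ comes from the second coordinate
    -- and then h₂ from the first.
    h₁ : x /ℕ n ≡ x′ /ℕ n [mod 2 ]
    h₁ = subst₂ (_≡_[mod 2 ]) (eq (x /ℕ n) (y /ℕ k)) (eq (x′ /ℕ n) (y′ /ℕ k))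
      (*-mod-2n⇒mod-2 {k} (mod-cancelʳ q′ (mod-reflexive (cong proj₂ σ-rep≡))))
      where
      eq : ∀ a b → a + b - b ≡ a
      eq = solve-∀

    h₂ : y /ℕ k ≡ y′ /ℕ k [mod 2 ]
    h₂ = mod-cancelʳ (*-mod-2n⇒mod-2 {n} (mod-cancelʳ p′ (mod-reflexive (cong proj₁ σ-rep≡))))
      (mod-neg h₁)

-- Halving both factors together ends when one of them is ℤ/2, where the explicit map or its swap
-- applies. The exponents start at 1 because a nontrivial cyclic 2-group has no orthomorphism.
orthomorphism : ∀ a b → Orthomorphism (2 ^ suc a) (2 ^ suc b)
orthomorphism a zero = orthomorphism-2n×2 (2 ^ a) {{ℕ.m^n≢0 2 a}}
orthomorphism zero (suc b) =
  orthomorphism-swap (orthomorphism-2n×2 (2 ^ suc b) {{ℕ.m^n≢0 2 (suc b)}})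
orthomorphism (suc a) (suc b) =
  orthomorphism-double (2 ^ suc a) (2 ^ suc b)
    {{ℕ.m^n≢0 2 (suc a)}} {{ℕ.m^n≢0 2 (suc b)}} (orthomorphism a b)

-- Orthogonality from joint injectivity.

module _ {a q} (F : FiniteField a q) where
  open FiniteField F using (Carrier; c)

  -- The pair of polynomials is a self-map of the finite set `Carrier × Carrier`: injectivity gives
  -- uniqueness directly and existence by counting.
  injective⇒orthogonal : (f g : Poly F) →
    (∀ {x y x′ y′} → eval F f x y ≡ eval F f x′ y′ → eval F g x y ≡ eval F g x′ y′ →
                     (x , y) ≡ (x′ , y′)) →
    Orthogonal F f g
  injective⇒orthogonal f g inj u v =
    proj₁ hit , (cong proj₁ (proj₂ hit) , cong proj₂ (proj₂ hit)) ,
    λ (fxy , gxy) → inj (trans (cong proj₁ (proj₂ hit)) (sym fxy))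
                        (trans (cong proj₂ (proj₂ hit)) (sym gxy))
    where
    eval² : Carrier × Carrier → Carrier × Carrier
    eval² (x , y) = eval F f x y , eval F g x y

    eval²-injective : Injective _≡_ _≡_ eval²
    eval²-injective eq = inj (cong proj₁ eq) (cong proj₂ eq)

    hit : ∃ λ xy → eval² xy ≡ (u , v)
    hit = injective⇒surjective (↔-trans Fin.*↔× (c ×-↔ c)) eval²-injective (u , v)

-- The translation action of G

module Positions {a q} (F : FiniteField a q) (ℓ t : ℕ) (t*ℓ≡q : t ℕ.* ℓ ≡ q) where
  open FiniteField F using (Carrier; c; _≟_)
  open Group F ℓ t t*ℓ≡q
  open Endo Carrier using () renaming (_^_ to _^ᵉ_)

  index : Carrier → Fin t × Fin ℓ
  index x = remQuot ℓ (cast (sym t*ℓ≡q) (from c x))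

  index-c : ∀ i j → index c[ i , j ] ≡ (i , j)
  index-c i j = begin
    remQuot ℓ (cast (sym t*ℓ≡q) (from c c[ i , j ]))
      ≡⟨ cong (remQuot ℓ ∘ cast (sym t*ℓ≡q)) (strictlyInverseʳ c _) ⟩
    remQuot ℓ (cast (sym t*ℓ≡q) (cast t*ℓ≡q (combine i j)))
      ≡⟨ cong (remQuot ℓ) (Fin.cast-involutive (sym t*ℓ≡q) t*ℓ≡q (combine i j)) ⟩
    remQuot ℓ (combine i j)
      ≡⟨ Fin.remQuot-combine i j ⟩
    (i , j) ∎
    where open ≡-Reasoning

  c-index : ∀ x → c[ proj₁ (index x) , proj₂ (index x) ] ≡ x
  c-index x = begin
    to c (cast t*ℓ≡q (uncurry combine (index x)))
      ≡⟨ cong (to c ∘ cast t*ℓ≡q) (Fin.combine-remQuot {t} ℓ (cast (sym t*ℓ≡q) (from c x))) ⟩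
    to c (cast t*ℓ≡q (cast (sym t*ℓ≡q) (from c x)))
      ≡⟨ cong (to c) (Fin.cast-involutive t*ℓ≡q (sym t*ℓ≡q) (from c x)) ⟩
    to c (from c x)
      ≡⟨ strictlyInverseˡ c x ⟩
    x ∎
    where open ≡-Reasoning

  c-injective : ∀ {i i′ j j′} → c[ i , j ] ≡ c[ i′ , j′ ] → i ≡ i′ × j ≡ j′
  c-injective {i} {i′} {j} {j′} eq = ,-injective
    (trans (sym (index-c i j)) (trans (cong index eq) (index-c i′ j′)))

  -- Coordinates are integers compared modulo (t , ℓ), so that arithmetic in ℤ/t × ℤ/ℓ becomes ring
  -- arithmetic in ℤ.
  pos : Carrier → ℤ²
  pos x = + toℕ (proj₁ (index x)) , + toℕ (proj₂ (index x))

  pos-c : ∀ i j → pos c[ i , j ] ≡ (+ toℕ i , + toℕ j)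
  pos-c i j = cong (λ (i , j) → + toℕ i , + toℕ j) (index-c i j)

  pos-injective : ∀ {x y} → pos x ≡ pos y [mod² t , ℓ ] → x ≡ y
  pos-injective {x} {y} (p , q) = trans (sym (c-index x)) (trans
    (cong₂ c[_,_] (fin≡ p) (fin≡ q)) (c-index y))
    where
    fin≡ : ∀ {n} {i j : Fin n} → + toℕ i ≡ + toℕ j [mod n ] → i ≡ j
    fin≡ {i = i} {j} p = Fin.toℕ-injective (mod⇒≡ (Fin.toℕ<n i) (Fin.toℕ<n j) p)

  module _ .{{_ : NonZero t}} .{{_ : NonZero ℓ}} where

    point : ℤ² → Carrier
    point (a , b) = c[ fromℕ< (n%ℕd<d a t) , fromℕ< (n%ℕd<d b ℓ) ]

    pos-point : ∀ u → pos (point u) ≡ u [mod² t , ℓ ]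
    pos-point u@(a , b) = subst (_≡ u [mod² t , ℓ ])
      (sym (trans (pos-c _ _) (cong₂ (λ i j → + i , + j)
        (Fin.toℕ-fromℕ< (n%ℕd<d a t)) (Fin.toℕ-fromℕ< (n%ℕd<d b ℓ)))))
      (%-≡-mod a , %-≡-mod b)

    point-injective : ∀ {u v} → point u ≡ point v → u ≡ v [mod² t , ℓ ]
    point-injective {u} {v} eq = mod²-trans (mod²-sym (pos-point u))
      (subst (λ x → pos x ≡ v [mod² t , ℓ ]) (sym eq) (pos-point v))

  α-c : ∀ i j → α c[ i , j ] ≡ c[ i , next j ]
  α-c = ∏-cycle-∈ _≟_ c[_,_] c-injective

  β-c : ∀ i j → β c[ i , j ] ≡ c[ next i , j ]
  β-c i j = ∏-cycle-∈ _≟_ (λ j i → c[ i , j ]) (swap ∘ c-injective) j i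

  Shifts : (Carrier → Carrier) → ℤ² → Set a
  Shifts h d = ∀ x → pos (h x) ⊝ pos x ≡ d [mod² t , ℓ ]

  shifts-∘ : ∀ {h k d e} → Shifts h d → Shifts k e →
             Shifts (h ∘′ k) (proj₁ d + proj₁ e , proj₂ d + proj₂ e)
  shifts-∘ {h} {k} h-d k-e x =
    telescope (pos₁ (h (k x))) (pos₁ (k x)) (pos₁ x) (mod₁ (h-d (k x))) (mod₁ (k-e x)) ,
    telescope (pos₂ (h (k x))) (pos₂ (k x)) (pos₂ x) (mod₂ (h-d (k x))) (mod₂ (k-e x))
    where
    pos₁ pos₂ : Carrier → ℤ
    pos₁ = proj₁ ∘ pos
    pos₂ = proj₂ ∘ pos

    telescope : ∀ {n d e} a b c → a - b ≡ d [mod n ] → b - c ≡ e [mod n ] → a - c ≡ d + e [mod n ]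
    telescope {n} {d} {e} a b c p q =
      subst (_≡ d + e [mod n ]) (eq a b c) (mod-+ p q)
      where
      eq : ∀ a b c → a - b + (b - c) ≡ a - c
      eq = solve-∀

  shifts-by-c : ∀ {h d} → (∀ i j → pos (h c[ i , j ]) ⊝ (+ toℕ i , + toℕ j) ≡ d [mod² t , ℓ ]) →
                Shifts h d
  shifts-by-c {h} {d} p x = subst (λ y → pos (h y) ⊝ pos x ≡ d [mod² t , ℓ ]) (c-index x)
    (p (proj₁ (index x)) (proj₂ (index x)))

  next-shift : ∀ {n} (k : Fin n) → + toℕ (next k) - + toℕ k ≡ + 1 [mod n ]
  next-shift {n} k = subst (+ toℕ (next k) - + toℕ k ≡_[mod n ]) (eq (+ toℕ k))
    (mod-- (toℕ-next k) (mod-reflexive (refl {x = + toℕ k})))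
    where
    eq : ∀ k → k + + 1 - k ≡ + 1
    eq = solve-∀

  α-shifts : Shifts α (+ 0 , + 1)
  α-shifts = shifts-by-c shift
    where
    shift : ∀ i j → pos (α c[ i , j ]) ⊝ (+ toℕ i , + toℕ j) ≡ (+ 0 , + 1) [mod² t , ℓ ]
    shift i j = subst (λ u → u ⊝ (+ toℕ i , + toℕ j) ≡ (+ 0 , + 1) [mod² t , ℓ ])
      (sym (trans (cong pos (α-c i j)) (pos-c i (next j))))
      (mod-reflexive (ℤ.+-inverseʳ (+ toℕ i)) , next-shift j)

  β-shifts : Shifts β (+ 1 , + 0)
  β-shifts = shifts-by-c shift
    where
    shift : ∀ i j → pos (β c[ i , j ]) ⊝ (+ toℕ i , + toℕ j) ≡ (+ 1 , + 0) [mod² t , ℓ ]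
    shift i j = subst (λ u → u ⊝ (+ toℕ i , + toℕ j) ≡ (+ 1 , + 0) [mod² t , ℓ ])
      (sym (trans (cong pos (β-c i j)) (pos-c (next i) j)))
      (next-shift i , mod-reflexive (ℤ.+-inverseʳ (+ toℕ j)))

  shifts-^ : ∀ {h d} → Shifts h d → ∀ n → ∃ (Shifts (h ^ᵉ n))
  shifts-^ h-d zero    = (+ 0 , + 0) , λ x →
    mod-reflexive (ℤ.+-inverseʳ (proj₁ (pos x))) , mod-reflexive (ℤ.+-inverseʳ (proj₂ (pos x)))
  shifts-^ h-d (suc n) = _ , shifts-∘ h-d (proj₂ (shifts-^ h-d n))

  -- The shift is (j , i), but it stays existential: what matters later is that it is the same at
  -- every point.
  g-shifts : ∀ i j → ∃ (Shifts g[ i , j ])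
  g-shifts i j = _ , shifts-∘ (proj₂ (shifts-^ α-shifts (toℕ i))) (proj₂ (shifts-^ β-shifts (toℕ j)))

  -- If f(x , y) = c_k, then y = τ_k(x), and τ_k is a translation, so y - x depends on `k` alone.
  tuple-difference : (f : Poly F) (τ : Vector (Carrier ↔ Carrier) q) →
    IsLPP F f → IsTupleOf F f τ → ConsistsOfG τ →
    ∀ {x y x′ y′} → eval F f x y ≡ eval F f x′ y′ →
    pos y ⊝ pos x ≡ pos y′ ⊝ pos x′ [mod² t , ℓ ]
  tuple-difference f τ (_ , f-bij) f-τ (τ-G , _) {x} {y} {x′} {y′} eq
    = mod²-trans (difference x y) (subst (λ k → d k ≡ pos y′ ⊝ pos x′ [mod² t , ℓ ])
        (cong (from c) (sym eq)) (mod²-sym (difference x′ y′)))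
    where
    τ-shifts : ∀ k → ∃ (Shifts (to (τ k)))
    τ-shifts k = let i , j , τₖ≗g = τ-G k ; d , g-d = g-shifts i j in
      d , λ x → subst (λ y → pos y ⊝ pos x ≡ d [mod² t , ℓ ]) (sym (τₖ≗g x)) (g-d x)

    d : Fin q → ℤ²
    d k = proj₁ (τ-shifts k)

    difference : ∀ u v → pos v ⊝ pos u ≡ d (from c (eval F f u v)) [mod² t , ℓ ]
    difference u v = subst (λ w → pos w ⊝ pos u ≡ d k [mod² t , ℓ ]) τₖu≡v (proj₂ (τ-shifts k) u)
      where
      k = from c (eval F f u v)

      -- Both `to (τ k) u` and `v` solve f(u , Y) = c_k, and `f` is injective in its second
      -- argument.
      τₖu≡v : to (τ k) u ≡ v
      τₖu≡v = proj₁ (f-bij u) (trans (f-τ k u) (strictlyInverseˡ c (eval F f u v)))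

  -- The companion given by an orthomorphism.

  -- Injectivity of `σ` makes `g` a permutation in its first argument, and cancellation of σ(x) does
  -- so in the second; injectivity of σ - id gives orthogonality. Finiteness turns each injection
  -- into a bijection.
  companion : .{{_ : NonZero t}} .{{_ : NonZero ℓ}} → Orthomorphism t ℓ → (f : Poly F) →
    (∀ {x y x′ y′} → eval F f x y ≡ eval F f x′ y′ →
                     pos y ⊝ pos x ≡ pos y′ ⊝ pos x′ [mod² t , ℓ ]) →
    ∃ λ (g : Poly F) → IsCompanion F f g
  companion θ f f-diff = g ,
    ((λ y → injective⇒bijective c (x-inj y)) , (λ x → injective⇒bijective c (y-inj x))) ,
    injective⇒orthogonal F f g fg-inj
    where
    open Orthomorphism θ
    open Interpolation F using (represent)

    h : Carrier → Carrier → Carrier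
    h x y = point (pos y ⊝ σ (pos x))

    g : Poly F
    g = proj₁ (represent h)

    g-diff : ∀ {x y x′ y′} → eval F g x y ≡ eval F g x′ y′ →
             pos y ⊝ σ (pos x) ≡ pos y′ ⊝ σ (pos x′) [mod² t , ℓ ]
    g-diff {x} {y} {x′} {y′} eq = point-injective {pos y ⊝ σ (pos x)} {pos y′ ⊝ σ (pos x′)}
      (trans (sym (proj₂ (represent h) x y)) (trans eq (proj₂ (represent h) x′ y′)))

    y-inj : ∀ x {y y′} → eval F g x y ≡ eval F g x y′ → y ≡ y′
    y-inj x {y} {y′} eq = pos-injective (⊝-cancelʳ (σ (pos x)) (pos y) (pos y′) (g-diff eq))

    x-inj : ∀ y {x x′} → eval F g x y ≡ eval F g x′ y → x ≡ x′
    x-inj y {x} {x′} eq = pos-injective (σ-inj (pos x) (pos x′)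
      (⊝-cancelˡ (pos y) (σ (pos x)) (σ (pos x′)) (g-diff eq)))

    fg-inj : ∀ {x y x′ y′} → eval F f x y ≡ eval F f x′ y′ → eval F g x y ≡ eval F g x′ y′ →
             (x , y) ≡ (x′ , y′)
    fg-inj {x} {y} {x′} {y′} f-eq g-eq = cong₂ _,_ x≡x′ y≡y′
      where
      x≡x′ : x ≡ x′
      x≡x′ = pos-injective (δ-inj (pos x) (pos x′)
        (⊝-⊝ (pos y) (pos x) (σ (pos x)) (pos y′) (pos x′) (σ (pos x′)) (f-diff f-eq) (g-diff g-eq)))

      y≡y′ : y ≡ y′
      y≡y′ = y-inj x (trans g-eq (cong (λ z → eval F g z y′) (sym x≡x′)))

-- Klenian polynomials for q = 2^m.

theorem4p6 : ∀ {a} (m e : ℕ) → 1 ≤ e → (e<m : e < m) →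
    (F : FiniteField a (2 ^ m)) (f : Poly F) →
    IsKlenian 2 m e e<m F f → ∃ λ (g : Poly F) → IsCompanion F f g
theorem4p6 m e@(suc e-1) 1≤e e<m F f (f-LPP , τ , _ , f-τ , τ-G) =
  companion {{t≢0}} {{ℕ.m^n≢0 2 e}} θ f (tuple-difference f τ f-LPP f-τ τ-G)
  where
  open Positions F (ℓ 2 m e) (t 2 m e) (t*ℓ≡q 2 m e e<m)

  -- The exponent m - e is written as a successor, which `e<m` permits.
  t≡2^ : t 2 m e ≡ 2 ^ suc (m ∸ suc e)
  t≡2^ = ℕ.*-cancelʳ-≡ _ _ (2 ^ e) {{ℕ.m^n≢0 2 e}} (begin
    t 2 m e ℕ.* 2 ^ e               ≡⟨ t*ℓ≡q 2 m e e<m ⟩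
    2 ^ m                           ≡⟨ cong (2 ^_) (ℕ.m∸n+n≡m e<m) ⟨
    2 ^ (m ∸ suc e ℕ.+ suc e)       ≡⟨ cong (2 ^_) (ℕ.+-suc (m ∸ suc e) e) ⟩
    2 ^ (suc (m ∸ suc e) ℕ.+ e)     ≡⟨ ℕ.^-distribˡ-+-* 2 (suc (m ∸ suc e)) e ⟩
    2 ^ suc (m ∸ suc e) ℕ.* 2 ^ e   ∎)
    where open ≡-Reasoning

  t≢0 : NonZero (t 2 m e)
  t≢0 = subst NonZero (sym t≡2^) (ℕ.m^n≢0 2 (suc (m ∸ suc e)))

  -- Both factors are even: `t` by `t≡2^`, and `ℓ` because `e` is `suc e-1`.
  θ : Orthomorphism (t 2 m e) (ℓ 2 m e)
  θ = subst (λ t → Orthomorphism t (2 ^ e)) (sym t≡2^) (orthomorphism (m ∸ suc e) e-1)
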